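{- Let $a \ge 2$, $t\ge 2$ and $n \ge 1$ be integers. For every $t$-wise perfect set $\mathcal{V}$ of vectors of length $n$ over the alphabet $\Sigma_a=\{0,1,\ldots,a-1\}$ there is a family $\mathcal{P}$ of $t$-wise properly overlapping $a$-partitions of $[n]$ of the same size, in one-to-one correspondence with $\mathcal{V}$. Conversely, for every family $\mathcal{P}$ of $t$-wise properly overlapping $a$-partitions of $[n]$ there is a $t$-wise perfect set $\mathcal{V}$ of vectors of length $n$ over $\Sigma_a$ of the same size, in one-to-one correspondence with $\mathcal{P}$.
   Context: $[n]=\{1,2,\ldots,n\}$. For a vector $\mathbf{v}\in\Sigma_a^n$ and $r\in[n]$, $\mathbf{v}[r]$ is its $r$-th coordinate. A set of vectors $\mathcal{V}=\{\mathbf{v}_1,\ldots,\mathbf{v}_k\}\subseteq \Sigma_a^n$ is called $t$-wise perfect with respect to $\Sigma_a$ if (i) $|\mathcal{V}|\ge t$, and (ii) for every $t$-tuple $(\mathbf{v}_{i_1},\ldots,\mathbf{v}_{i_t})$ with $1\le i_1<i_2<\cdots<i_t\le k$ and every string $\alpha\in\Sigma_a^t$, there is some $r\in[n]$ with $\mathbf{v}_{i_1}[r]\cdots\mathbf{v}_{i_t}[r]=\alpha$. An $a$-partition of a set is an unordered partition of it into $a$ parts. A family $\mathcal{P}$ of $a$-partitions of $[n]$ is $t$-wise properly overlapping if (i) $|\mathcal{P}|\ge t$, and (ii) for any subfamily of $t$ (distinct) $a$-partitions $P_1,\ldots,P_t$ in $\mathcal{P}$, the intersection of any $t$ parts, with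 one part taken from each $P_i$, is nonempty. -}

module Defs where

open import Level using (Level; 0ℓ; _⊔_)
open import Data.Nat using (ℕ; _≤_)
open import Data.Fin using (Fin; _<_)
open import Data.Fin.Subset using (Subset; _∈_; _∩_; ⋂; Nonempty; Empty)
open import Data.List as List using ()
open import Data.Vec using (Vec; lookup; tabulate)
open import Data.Product using (Σ-syntax; ∃-syntax; _×_; proj₁)
open import Function using (_⇔_)
open import Function.Definitions using (Injective)
open import Function.Properties.Equivalence using (⇔-isEquivalence)
open import Relation.Binary using (Setoid; IsEquivalence; _Preserves_⟶_)
open import Relation.Binary.PropositionalEquality using (_≡_; _≢_; setoid)
import Relation.Binary.Construct.On as On

private
  variable
    c ℓ : Level
    a n : ℕ

-- A finite set of elements of S, given by a repetition-free enumeration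
-- x₁, …, xₖ; its elements are considered only up to the equality of S.
record FiniteSet (S : Setoid c ℓ) : Set (c ⊔ ℓ) where
  open Setoid S
  field
    size      : ℕ
    enum      : Fin size → Carrier
    injective : Injective _≡_ _≈_ enum

  Member : Carrier → Set ℓ
  Member x = ∃[ i ] enum i ≈ x

  Elements : Setoid (c ⊔ ℓ) ℓ
  Elements = On.setoid {B = Σ[ x ∈ Carrier ] Member x} S proj₁

-- The alphabet Σ_a is Fin a and the ground set [n] is Fin n.
VectorSet : ℕ → ℕ → Set
VectorSet a n = FiniteSet (setoid (Vec (Fin a) n))

TWisePerfect : ℕ → VectorSet a n → Set
TWisePerfect {a} {n} t V =
  t ≤ size ×
  ((ι : Fin t → Fin size) → ι Preserves _<_ ⟶ _<_ →
   (α : Vec (Fin a) t) →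
   ∃[ r ] tabulate (λ j → lookup (enum (ι j)) r) ≡ α)
  where open FiniteSet V

-- The indexing of the parts is forgotten by the equality _≈ₚ_ below.
record Partition (a n : ℕ) : Set where
  field
    part     : Fin a → Subset n
    nonempty : ∀ i → Nonempty (part i)
    disjoint : ∀ {i j} → i ≢ j → Empty (part i ∩ part j)
    cover    : ∀ r → ∃[ i ] r ∈ part i

_IsPartOf_ : Subset n → Partition a n → Set
S IsPartOf P = ∃[ i ] Partition.part P i ≡ S

_≈ₚ_ : Partition a n → Partition a n → Set
P ≈ₚ Q = ∀ S → S IsPartOf P ⇔ S IsPartOf Q

≈ₚ-isEquivalence : IsEquivalence (_≈ₚ_ {a = a} {n = n})
≈ₚ-isEquivalence = record
  { refl  = λ _ → E.refl
  ; sym   = λ p S → E.sym (p S)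
  ; trans = λ p q S → E.trans (p S) (q S)
  }
  where module E = IsEquivalence (⇔-isEquivalence {0ℓ})

partitionSetoid : ℕ → ℕ → Setoid 0ℓ 0ℓ
partitionSetoid a n = record { isEquivalence = ≈ₚ-isEquivalence {a = a} {n = n} }

PartitionFamily : ℕ → ℕ → Set
PartitionFamily a n = FiniteSet (partitionSetoid a n)

TWiseProperlyOverlapping : ℕ → PartitionFamily a n → Set
TWiseProperlyOverlapping {a} {n} t 𝒫 =
  t ≤ size ×
  ((P : Fin t → Partition a n) → (∀ j → Member (P j)) →
   Injective _≡_ _≈ₚ_ P →
   (Q : Fin t → Subset n) → (∀ j → Q j IsPartOf P j) →
   Nonempty (⋂ (List.tabulate Q)))
  where open FiniteSet 𝒫

{-# OPTIONS --safe #-}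
-- A vector v corresponds to the partition whose parts are its level sets
-- {r : v[r] = x}, and a partition to the vector recording the index of the part
-- that contains each point.  Under this correspondence a string occurring at
-- position r in t vectors is a point r common to the chosen parts.  Forgetting
-- the indexing of the parts loses nothing: if two distinct vectors of a perfect
-- set had the same level sets, a level set of one would meet two distinct
-- (hence disjoint) level sets of the other while being equal to one of them.
module Submission where

open import Level using (Level)
open import Data.Nat using (ℕ; zero; suc; _≤_; s≤s; z<s; s<s; s<s⁻¹)
open import Data.Nat.Properties using (≤-trans)
open import Data.Fin as Fin using (Fin; zero; suc; _≟_; inject≤; punchIn; punchOut)
open import Data.Fin.Permutation as Perm using (Permutation; _⟨$⟩ʳ_; _⟨$⟩ˡ_)
open import Data.Fin.Properties
  using (any?; <-cmp; <-irrefl; 0≢1+n; inject≤-injective;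
         punchInᵢ≢i; punchIn-injective; punchIn-punchOut; punchOut-injective)
open import Data.Fin.Subset using (Subset; _∈_; ⋂)
open import Data.Fin.Subset.Properties using (∈⊤; x∈p∩q⁺; x∈p∩q⁻; ⊆-antisym)
open import Data.List as List using ()
open import Data.Product using (Σ-syntax; ∃-syntax; _×_; _,_; proj₁; proj₂)
open import Data.Vec using (Vec; lookup; tabulate)
open import Data.Vec.Functional using (_∷_)
open import Data.Vec.Properties
  using ([]=⇒lookup; lookup⇒[]=; lookup∘tabulate; tabulate∘lookup; tabulate-cong)
open import Function using (_∘_; mk⇔)
open import Function.Bundles using (Bijection; Equivalence)
open import Function.Definitions using (Injective)
open import Relation.Binary using (Setoid; tri<; tri≈; tri>; _Preserves_⟶_)
open import Relation.Binary.PropositionalEquality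
  using (_≡_; _≢_; refl; sym; trans; cong; subst; subst₂; setoid)
open import Relation.Nullary using (does; yes; no; contradiction)
open import Relation.Nullary.Decidable using (dec-true; decidable-stable)
open import Defs
open FiniteSet using (size; Elements)

private
  variable
    c ℓ c′ ℓ′ : Level
    a k m n t : ℕ

-- Index tuples: increasing, injective, extended from pairs.

increasing⇒injective : {f : Fin m → Fin k} → f Preserves Fin._<_ ⟶ Fin._<_ →
                       Injective _≡_ _≡_ f
increasing⇒injective mono {i} {j} eq with <-cmp i j
... | tri< i<j _ _ = contradiction (mono i<j) (<-irrefl eq)
... | tri≈ _ i≡j _ = i≡j
... | tri> _ _ j<i = contradiction (mono j<i) (<-irrefl (sym eq))

-- Induction on `k`: if `zero` is not a value, all values shift down by one; otherwise the index
-- attaining it comes first and the remaining ones, whose values are positive, are sorted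
-- recursively.
sortable : (f : Fin m → Fin k) → Injective _≡_ _≡_ f →
           Σ[ π ∈ Permutation m m ] (f ∘ (π ⟨$⟩ʳ_)) Preserves Fin._<_ ⟶ Fin._<_
sortable {zero}          f inj = Perm.id , λ { {()} }
sortable {suc m} {zero}  f inj with () ← f zero
sortable {suc m} {suc k} f inj with any? (λ j → zero ≟ f j)
... | no 0∉f = π , λ i<j → subst₂ Fin._<_ (suc-f′ _) (suc-f′ _) (s<s (mono i<j))
  where
  0≢f : ∀ j → zero ≢ f j
  0≢f j eq = 0∉f (j , eq)

  f′ : Fin (suc m) → Fin k
  f′ j = punchOut (0≢f j)

  suc-f′ : ∀ j → suc (f′ j) ≡ f j
  suc-f′ j = punchIn-punchOut (0≢f j)

  rec = sortable f′ λ eq → inj (punchOut-injective (0≢f _) (0≢f _) eq)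
  π = proj₁ rec
  mono = proj₂ rec
... | yes (j₀ , 0≡fj₀) = Perm.insert zero j₀ π , increasing
  where
  0≢f : ∀ j → zero ≢ f (punchIn j₀ j)
  0≢f j eq = punchInᵢ≢i j₀ j (inj (trans (sym eq) 0≡fj₀))

  f′ : Fin m → Fin k
  f′ j = punchOut (0≢f j)

  rec = sortable f′ λ eq → punchIn-injective j₀ _ _ (inj (punchOut-injective (0≢f _) (0≢f _) eq))
  π = proj₁ rec
  mono = proj₂ rec

  suc-f′ : ∀ j → suc (f′ j) ≡ f (punchIn j₀ j)
  suc-f′ j = punchIn-punchOut (0≢f j)

  increasing : (f ∘ (Perm.insert zero j₀ π ⟨$⟩ʳ_)) Preserves Fin._<_ ⟶ Fin._<_
  increasing {zero}  {suc j} _   = subst₂ Fin._<_ 0≡fj₀ (suc-f′ _) z<s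
  increasing {suc i} {suc j} i<j = subst₂ Fin._<_ (suc-f′ _) (suc-f′ _) (s<s (mono (s<s⁻¹ i<j)))

∷-punchIn-injective : (i : Fin (suc n)) {g : Fin m → Fin n} → Injective _≡_ _≡_ g →
                      Injective _≡_ _≡_ (i ∷ (punchIn i ∘ g))
∷-punchIn-injective i inj {zero}  {zero}  eq = refl
∷-punchIn-injective i inj {zero}  {suc y} eq = contradiction (sym eq) (punchInᵢ≢i i _)
∷-punchIn-injective i inj {suc x} {zero}  eq = contradiction eq (punchInᵢ≢i i _)
∷-punchIn-injective i inj {suc x} {suc y} eq = cong suc (inj (punchIn-injective i _ _ eq))

-- Lets a condition on `t`-tuples be applied to two given indices.
extend-pair : 2 ≤ t → t ≤ k → {i j : Fin k} → i ≢ j →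
              Σ[ f ∈ (Fin t → Fin k) ] Injective _≡_ _≡_ f ×
                (∃[ x ] ∃[ y ] x ≢ y × f x ≡ i × f y ≡ j)
extend-pair (s≤s (s≤s _)) (s≤s (s≤s t≤k)) {i} i≢j =
  -- The inferred tuple starts with `i` and `j`, the latter as `punchIn i (punchOut i≢j)`, and goes
  -- on with indices that avoid both.
  _ ,
  ∷-punchIn-injective i (∷-punchIn-injective (punchOut i≢j) (inject≤-injective t≤k t≤k _ _)) ,
  zero , suc zero , 0≢1+n , refl , punchIn-punchOut i≢j

another : 2 ≤ k → (i : Fin k) → ∃[ j ] j ≢ i
another (s≤s (s≤s _)) i = punchIn i zero , punchInᵢ≢i i zero

∈⋂-tabulate⁺ : (Q : Fin t → Subset n) {r : Fin n} → (∀ j → r ∈ Q j) → r ∈ ⋂ (List.tabulate Q)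
∈⋂-tabulate⁺ {t = zero}  Q r∈ = ∈⊤
∈⋂-tabulate⁺ {t = suc t} Q r∈ = x∈p∩q⁺ (r∈ zero , ∈⋂-tabulate⁺ (Q ∘ suc) (r∈ ∘ suc))

∈⋂-tabulate⁻ : (Q : Fin t → Subset n) {r : Fin n} → r ∈ ⋂ (List.tabulate Q) → ∀ j → r ∈ Q j
∈⋂-tabulate⁻ Q r∈ zero    = proj₁ (x∈p∩q⁻ (Q zero) _ r∈)
∈⋂-tabulate⁻ Q r∈ (suc j) = ∈⋂-tabulate⁻ (Q ∘ suc) (proj₂ (x∈p∩q⁻ (Q zero) _ r∈)) j

-- Finite sets sharing an index set.

module _ {S : Setoid c ℓ} (X : FiniteSet S) (T : Setoid c′ ℓ′) where
  private
    module S = Setoid S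
    module T = Setoid T
    module X = FiniteSet X

  reenumerate : (y : Fin X.size → T.Carrier) → Injective _≡_ T._≈_ y → FiniteSet T
  reenumerate y inj = record { size = X.size ; enum = y ; injective = inj }

  -- Elements with the same index are matched. The index is read off the membership witness; as `X`
  -- has no repetitions, equal elements have equal indices, so the map respects equality.
  reenumerate-bijection : (y : Fin X.size → T.Carrier) (inj : Injective _≡_ T._≈_ y) →
                          Bijection (Elements X) (Elements (reenumerate y inj))
  reenumerate-bijection y inj = record
    { to   = λ (_ , i , _) → y i , i , T.refl
    ; cong = λ { {_ , i , p} {_ , j , q} eq →
               T.reflexive (cong y (X.injective (S.trans p (S.trans eq (S.sym q))))) }
    ; bijective =
        (λ { {_ , i , p} {_ , j , q} eq →
             S.trans (S.sym p) (S.trans (S.reflexive (cong X.enum (inj eq))) q) }) ,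
        (λ (_ , i , p) → (X.enum i , i , S.refl) ,
           λ { {_ , j , q} eq → T.trans (T.reflexive (cong y (X.injective (S.trans q eq)))) p })
    }

-- Level sets of a vector and labels of a partition.

level : Vec (Fin a) n → Fin a → Subset n
level v x = tabulate (λ r → does (lookup v r ≟ x))

∈-level⁺ : (v : Vec (Fin a) n) {x : Fin a} {r : Fin n} → lookup v r ≡ x → r ∈ level v x
∈-level⁺ v {x} {r} eq =
  lookup⇒[]= r _ (trans (lookup∘tabulate _ r) (dec-true (lookup v r ≟ x) eq))

∈-level⁻ : (v : Vec (Fin a) n) {x : Fin a} {r : Fin n} → r ∈ level v x → lookup v r ≡ x
∈-level⁻ v {x} {r} r∈ with lookup v r ≟ x | trans (sym (lookup∘tabulate _ r)) ([]=⇒lookup r∈)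
... | yes eq | _ = eq

levelPartition : (v : Vec (Fin a) n) → (∀ x → ∃[ r ] lookup v r ≡ x) → Partition a n
levelPartition v onto = record
  { part     = level v
  ; nonempty = λ x → let r , eq = onto x in r , ∈-level⁺ v eq
  ; disjoint = λ {x} {y} x≢y (r , r∈) →
      let r∈x , r∈y = x∈p∩q⁻ (level v x) (level v y) r∈
      in x≢y (trans (sym (∈-level⁻ v r∈x)) (∈-level⁻ v r∈y))
  ; cover    = λ r → lookup v r , ∈-level⁺ v refl
  }

module _ (P : Partition a n) where
  open Partition P

  labels : Vec (Fin a) n
  labels = tabulate (proj₁ ∘ cover)

  ∈-labels : ∀ r → r ∈ part (lookup labels r)
  ∈-labels r rewrite lookup∘tabulate (proj₁ ∘ cover) r = proj₂ (cover r)

  -- `cover` picks some part containing `r`; disjointness leaves no other choice.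
  ∈-part⇒label : ∀ {x r} → r ∈ part x → lookup labels r ≡ x
  ∈-part⇒label {x} {r} r∈ = decidable-stable (lookup labels r ≟ x)
    λ ≢x → disjoint ≢x (r , x∈p∩q⁺ (∈-labels r , r∈))

part-⊆ : (P Q : Partition a n) → labels P ≡ labels Q →
         ∀ x {r} → r ∈ Partition.part P x → r ∈ Partition.part Q x
part-⊆ P Q eq x {r} r∈ =
  subst (λ y → r ∈ Partition.part Q y)
        (trans (cong (λ v → lookup v r) (sym eq)) (∈-part⇒label P r∈))
        (∈-labels Q r)

labels-injective : (P Q : Partition a n) → labels P ≡ labels Q → P ≈ₚ Q
labels-injective P Q eq S = mk⇔
  (λ (x , p) → x , trans (sym (part≡ x)) p)
  (λ (x , p) → x , trans (part≡ x) p)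
  where
  part≡ : ∀ x → Partition.part P x ≡ Partition.part Q x
  part≡ x = ⊆-antisym (part-⊆ P Q eq x) (part-⊆ Q P (sym eq) x)

-- From perfect sets to overlapping families

module _ (2≤a : 2 ≤ a) (2≤t : 2 ≤ t) (V : VectorSet a n) (perfect : TWisePerfect t V) where
  open FiniteSet V renaming (size to ∣V∣; enum to v)

  private
    t≤∣V∣ = proj₁ perfect

  -- Perfection speaks of tuples with increasing indices; sorting removes the order.
  perfect-injective : (f : Fin t → Fin ∣V∣) → Injective _≡_ _≡_ f → (α : Fin t → Fin a) →
                      ∃[ r ] (∀ j → lookup (v (f j)) r ≡ α j)
  perfect-injective f inj α =
    let π , mono = sortable f inj
        -- The string is permuted along with the indices, so each vector keeps its prescribed
        -- symbol.
        r , eq   = proj₂ perfect (f ∘ (π ⟨$⟩ʳ_)) mono (tabulate (α ∘ (π ⟨$⟩ʳ_)))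
        sorted   = λ j → trans (sym (lookup∘tabulate _ j))
                               (trans (cong (λ w → lookup w j) eq) (lookup∘tabulate _ j))
    in r , λ j → subst (λ l → lookup (v (f l)) r ≡ α l) (Perm.inverseʳ π {j}) (sorted (π ⟨$⟩ˡ j))

  pair-occurs : {i j : Fin ∣V∣} → i ≢ j → ∀ x y → ∃[ r ] lookup (v i) r ≡ x × lookup (v j) r ≡ y
  pair-occurs i≢j x y with f , inj , p , q , p≢q , refl , refl ← extend-pair 2≤t t≤∣V∣ i≢j =
    let r , eq = perfect-injective f inj α in r , trans (eq p) αp , trans (eq q) αq
    where
    -- Only the entries at `p` and `q` matter; `y` also fills the padding positions.
    α : Fin _ → Fin _
    α l with l ≟ p
    ... | yes _ = x
    ... | no  _ = y

    αp : α p ≡ x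
    αp with p ≟ p
    ... | yes _ = refl
    ... | no ≢p = contradiction refl ≢p

    αq : α q ≡ y
    αq with q ≟ p
    ... | yes q≡p = contradiction (sym q≡p) p≢q
    ... | no _    = refl

  -- Makes every level set nonempty. Pairing with a second vector, available since `2 ≤ t ≤ ∣V∣`,
  -- reduces it to `pair-occurs`.
  vector-onto : ∀ i x → ∃[ r ] lookup (v i) r ≡ x
  vector-onto i x =
    let j , j≢i    = another (≤-trans 2≤t t≤∣V∣) i
        r , _ , eq = pair-occurs j≢i x x
    in r , eq

  vectorPartition : Fin ∣V∣ → Partition a n
  vectorPartition i = levelPartition (v i) (vector-onto i)

  -- As `2 ≤ a`, some `z ≢ y` exists; a position where `v i` has `x` and `v j` has `z` lies in only
  -- one of the two level sets.
  level-of-one : ∀ {i j} → i ≢ j → ∀ x y → level (v j) y ≢ level (v i) x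
  level-of-one {i} {j} i≢j x y eq =
    let z , z≢y     = another 2≤a y
        r , ix , jz = pair-occurs i≢j x z
        r∈y         = subst (r ∈_) (sym eq) (∈-level⁺ (v i) ix)
    in z≢y (trans (sym jz) (∈-level⁻ (v j) r∈y))

  vectorPartition-injective : Injective _≡_ _≈ₚ_ vectorPartition
  vectorPartition-injective {i} {j} P≈Q = decidable-stable (i ≟ j) λ i≢j →
    -- A single shared part is already contradictory, so any symbol serves.
    let x      = symbol 2≤a
        y , eq = Equivalence.to (P≈Q (level (v i) x)) (x , refl)
    in level-of-one i≢j x y eq
    where
    symbol : 2 ≤ a → Fin a
    symbol (s≤s _) = zero

  partitionFamily : PartitionFamily a n
  partitionFamily = reenumerate V (partitionSetoid a n) vectorPartition vectorPartition-injective

  partitionFamily-overlapping : TWiseProperlyOverlapping t partitionFamily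
  partitionFamily-overlapping = t≤∣V∣ , λ P mem distinct Q parts →
    let f : Fin t → Fin ∣V∣
        f = proj₁ ∘ mem

        f-injective : Injective _≡_ _≡_ f
        f-injective {i} {j} eq = distinct
          (≈.trans {P i} {vectorPartition (f i)} {P j}
            (≈.sym {vectorPartition (f i)} {P i} (proj₂ (mem i)))
            (subst (λ l → vectorPartition l ≈ₚ P j) (sym eq) (proj₂ (mem j))))

        -- `P j` agrees with a level partition only up to `_≈ₚ_`, so the symbol of the chosen part
        -- comes from the equivalence and not from the indexing of `P j`.
        level-is-Q : ∀ j → ∃[ x ] level (v (f j)) x ≡ Q j
        level-is-Q j = Equivalence.from (proj₂ (mem j) (Q j)) (parts j)

        r , eq = perfect-injective f f-injective (proj₁ ∘ level-is-Q)
    in r , ∈⋂-tabulate⁺ Q λ j →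
         subst (r ∈_) (proj₂ (level-is-Q j)) (∈-level⁺ (v (f j)) (eq j))
    where module ≈ = Setoid (partitionSetoid a n)

-- From overlapping families to perfect sets

module _ (𝒫 : PartitionFamily a n) where
  open FiniteSet 𝒫

  labels-enum-injective : Injective _≡_ _≡_ (labels ∘ enum)
  labels-enum-injective = injective ∘ labels-injective (enum _) (enum _)

  vectorSet : VectorSet a n
  vectorSet = reenumerate 𝒫 (setoid _) (labels ∘ enum) labels-enum-injective

  -- The string selects one part from each partition; a point common to these parts carries exactly
  -- the prescribed labels.
  vectorSet-perfect : TWiseProperlyOverlapping t 𝒫 → TWisePerfect t vectorSet
  vectorSet-perfect (t≤size , meet) = t≤size , λ ι mono α →
    let Q      = λ j → Partition.part (enum (ι j)) (lookup α j)
        r , r∈ = meet (enum ∘ ι) (λ j → ι j , ≈.refl {enum (ι j)})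
                   (increasing⇒injective mono ∘ injective) Q (λ j → lookup α j , refl)
    in r , trans (tabulate-cong λ j → ∈-part⇒label (enum (ι j)) (∈⋂-tabulate⁻ Q r∈ j))
                 (tabulate∘lookup α)
    where module ≈ = Setoid (partitionSetoid a n)

mainTheorem2 : (a t n : ℕ) → 2 ≤ a → 2 ≤ t → 1 ≤ n →
    ((V : VectorSet a n) → TWisePerfect t V →
    Σ[ P ∈ PartitionFamily a n ]
    (TWiseProperlyOverlapping t P × size P ≡ size V × Bijection (Elements V) (Elements P)))
    ×
    ((P : PartitionFamily a n) → TWiseProperlyOverlapping t P →
    Σ[ V ∈ VectorSet a n ]
    (TWisePerfect t V × size V ≡ size P × Bijection (Elements P) (Elements V)))
mainTheorem2 a t n 2≤a 2≤t _ =
  (λ V perfect →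
    partitionFamily 2≤a 2≤t V perfect ,
    partitionFamily-overlapping 2≤a 2≤t V perfect ,
    refl ,
    reenumerate-bijection V (partitionSetoid a n)
      (vectorPartition 2≤a 2≤t V perfect) (vectorPartition-injective 2≤a 2≤t V perfect)) ,
  (λ 𝒫 overlapping →
    vectorSet 𝒫 ,
    vectorSet-perfect 𝒫 overlapping ,
    refl ,
    reenumerate-bijection 𝒫 (setoid _) _ (labels-enum-injective 𝒫))
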